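{- For all selections $R, S$ and every sketch $\mathit{sk}$: the realizability triple $\langle R\rangle\,\mathit{sk}\,\langle S\rangle$ is derivable in realizability logic if and only if it is valid, i.e. $$\vdash_a \langle R\rangle\,\mathit{sk}\,\langle S\rangle \quad\Longleftrightarrow\quad \models_a \langle R\rangle\,\mathit{sk}\,\langle S\rangle .$$
   Context: **Parameters and predicates.** Fix an arbitrary set $\mathrm{States}$, a set $\mathrm{COM}$ of commands, and a semantics assigning to each $c\in\mathrm{COM}$ a function $[\![c]\!]:\mathrm{States}\to\mathrm{Predicates}$, where $\mathrm{Predicates}=\mathcal P(\mathrm{States})\cup\{\mathit{fail}\}$. Order predicates by $r\preceq_d s$ iff $s=\mathit{fail}$, or ($r\neq\mathit{fail}$ and $r\subseteq s$). The join of a set of predicates is $\mathit{fail}$ if $\mathit{fail}$ is a member, and the union of the members otherwise. Lift the semantics to predicates by $[\![c]\!](\mathit{fail})=\mathit{fail}$ and, for $r\ne\mathit{fail}$, $[\![c]\!](r)=\bigsqcup_d\{[\![c]\!](q)\mid q\in r\}$. **Programs.** $p ::= c \mid p;p \mid p+p \mid p^*$ with $c\in\mathrm{COM}$. $\mathit{exec}(p)$ is the set of executions of $p$: the language of $p$ seen as a regular expression over $\mathrm{COM}$. Executions are finite sequences of commands, with $[\![e_1;e_2]\!](r)=[\![e_2]\!]([\![e_1]\!](r))$ and the empty sequence acting as the identity. Validity in Hoare logic: $\models_d\{r\}\,p\,\{s\}$ iff $[\![e]\!](r)\preceq_d s$ for all $e\in\mathit{exec}(p)$. **Sketches.** $\mathit{sk}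 ::= c\mid \mathit{sk};\mathit{sk}\mid \mathit{sk}+\mathit{sk}\mid \mathit{sk}^*\mid N$, where $N$ ranges over a finite set of non-terminals, each with a nonempty set $\mathit{prod}(N)$ of sketches (productions). $N::=\mathit{sk}\mid\dots$ means $\mathit{sk}\in\mathit{prod}(N)$. $\mathit{drv}(\mathit{sk})$ is the set of all programs (without non-terminals) derivable from $\mathit{sk}$ by repeatedly replacing occurrences of non-terminals by their productions (as in a context-free grammar; different occurrences may be replaced differently; a starred sketch $\mathit{sk}^*$ derives the programs $p^*$ with $p\in\mathit{drv}(\mathit{sk})$). **Selections.** A selection is a finite set of predicates. $R\preceq_a S$ iff $\forall s\in S\,\exists r\in R.\ r\preceq_d s$. Validity: $\models_a\langle R\rangle\,\mathit{sk}\,\langle S\rangle$ iff $\forall s\in S\ \exists r\in R\ \exists p\in\mathit{drv}(\mathit{sk}).\ \models_d\{r\}\,p\,\{s\}$. **Realizability logic.** $\vdash_a$ is the least relation closed under: - (COM) if $[\![c]\!](r)\preceq_d s$ then $\vdash_a\langle\{r\}\rangle\,c\,\langle\{s\}\rangle$; - (SEQ) if $\vdash_a\langle R\rangle\,\mathit{sk}_1\,\langle S\rangle$ and $\vdash_a\langle S\rangle\,\mathit{sk}_2\,\langle T\rangle$ then $\vdash_a\langle R\rangle\,\mathit{sk}_1;\mathit{sk}_2\,\langle T\rangle$; - (LOOP) if $R=\{r\}$ and $\vdash_a\langle R\rangle\,\mathit{sk}\,\langle R\rangle$ then $\vdash_a\langle R\rangle\,\mathit{sk}^*\,\langle R\rangle$;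 - (CSQ) if $R\preceq_a R'$, $S'\preceq_a S$ and $\vdash_a\langle R'\rangle\,\mathit{sk}\,\langle S'\rangle$ then $\vdash_a\langle R\rangle\,\mathit{sk}\,\langle S\rangle$; - (DEM) if $R=\{r\}$, $\vdash_a\langle R\rangle\,\mathit{sk}_1\,\langle S\rangle$ and $\vdash_a\langle R\rangle\,\mathit{sk}_2\,\langle S\rangle$ then $\vdash_a\langle R\rangle\,\mathit{sk}_1+\mathit{sk}_2\,\langle S\rangle$; - (ANG) if $N::=\mathit{sk}\mid\dots$ and $\vdash_a\langle R\rangle\,\mathit{sk}\,\langle S\rangle$ then $\vdash_a\langle R\rangle\,N\,\langle S\rangle$; - (GATHER) if $\vdash_a\langle R_1\rangle\,\mathit{sk}\,\langle S_1\rangle$ and $\vdash_a\langle R_2\rangle\,\mathit{sk}\,\langle S_2\rangle$ then $\vdash_a\langle R_1\cup R_2\rangle\,\mathit{sk}\,\langle S_1\cup S_2\rangle$; - (EMPTY) $\vdash_a\langle R\rangle\,\mathit{sk}\,\langle\emptyset\rangle$ for all $R$ and $\mathit{sk}$. -}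

module Defs where

open import Axiom.ExcludedMiddle using (ExcludedMiddle)
open import Data.Empty.Polymorphic using (⊥)
open import Data.Fin.Base using (Fin)
open import Data.List.Base using (List; []; [_]; _++_; foldl)
open import Data.List.Membership.Propositional using () renaming (_∈_ to _∈ˡ_)
open import Data.Nat.Base using (ℕ)
open import Data.Product.Base using (Σ; ∃-syntax; _×_; proj₁)
open import Data.Sum.Base using (_⊎_)
open import Level using (Level; suc)
open import Relation.Binary.Construct.Closure.ReflexiveTransitive using (Star)
open import Relation.Binary.PropositionalEquality using (_≡_; _≢_)
open import Relation.Nullary using (yes; no)
open import Relation.Unary using (Pred)

private
  variable
    ℓ : Level

infixr 7 _⨾_
infixr 6 _⊕_
infix  8 _⋆

data Predicate (States : Set ℓ) : Set (suc ℓ) where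
  fail : Predicate States
  ⌜_⌝  : Pred States ℓ → Predicate States

data Program (Command : Set ℓ) : Set ℓ where
  com  : Command → Program Command
  _⨾_  : Program Command → Program Command → Program Command
  _⊕_  : Program Command → Program Command → Program Command
  _⋆   : Program Command → Program Command

-- Fin n is the finite set of non-terminals.
data Sketch (Command : Set ℓ) (n : ℕ) : Set ℓ where
  com  : Command → Sketch Command n
  _⨾_  : Sketch Command n → Sketch Command n → Sketch Command n
  _⊕_  : Sketch Command n → Sketch Command n → Sketch Command n
  _⋆   : Sketch Command n → Sketch Command n
  nt   : Fin n → Sketch Command n

module _ {Command : Set ℓ} where

  data exec : Program Command → Pred (List Command) ℓ where
    com   : ∀ {c} → exec (com c) [ c ]
    seq   : ∀ {p₁ p₂ e₁ e₂} → exec p₁ e₁ → exec p₂ e₂ → exec (p₁ ⨾ p₂) (e₁ ++ e₂)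
    left  : ∀ {p₁ p₂ e} → exec p₁ e → exec (p₁ ⊕ p₂) e
    right : ∀ {p₁ p₂ e} → exec p₂ e → exec (p₁ ⊕ p₂) e
    stop  : ∀ {p} → exec (p ⋆) []
    iter  : ∀ {p e₁ e₂} → exec p e₁ → exec (p ⋆) e₂ → exec (p ⋆) (e₁ ++ e₂)

  ⌊_⌋ : ∀ {n} → Program Command → Sketch Command n
  ⌊ com c ⌋   = com c
  ⌊ p₁ ⨾ p₂ ⌋ = ⌊ p₁ ⌋ ⨾ ⌊ p₂ ⌋
  ⌊ p₁ ⊕ p₂ ⌋ = ⌊ p₁ ⌋ ⊕ ⌊ p₂ ⌋
  ⌊ p ⋆ ⌋     = ⌊ p ⌋ ⋆

module Grammar {Command : Set ℓ} {n : ℕ} (prod : Fin n → Pred (Sketch Command n) ℓ) where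

  infix 4 _⇒_

  -- Replacement of a single occurrence of a non-terminal.
  data _⇒_ : Sketch Command n → Sketch Command n → Set ℓ where
    expand : ∀ {N sk} → prod N sk → nt N ⇒ sk
    seqˡ   : ∀ {sk₁ sk₁′ sk₂} → sk₁ ⇒ sk₁′ → sk₁ ⨾ sk₂ ⇒ sk₁′ ⨾ sk₂
    seqʳ   : ∀ {sk₁ sk₂ sk₂′} → sk₂ ⇒ sk₂′ → sk₁ ⨾ sk₂ ⇒ sk₁ ⨾ sk₂′
    altˡ   : ∀ {sk₁ sk₁′ sk₂} → sk₁ ⇒ sk₁′ → sk₁ ⊕ sk₂ ⇒ sk₁′ ⊕ sk₂
    altʳ   : ∀ {sk₁ sk₂ sk₂′} → sk₂ ⇒ sk₂′ → sk₁ ⊕ sk₂ ⇒ sk₁ ⊕ sk₂′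
    loop   : ∀ {sk sk′} → sk ⇒ sk′ → sk ⋆ ⇒ sk′ ⋆

  drv : Sketch Command n → Pred (Program Command) ℓ
  drv sk p = Star _⇒_ sk ⌊ p ⌋

module _ {States : Set ℓ} where

  infix 4 _∈_ _⊆_ _⪯d_

  -- The value at fail is a dummy: below, membership is only relevant for
  -- predicates other than fail.
  _∈_ : States → Predicate States → Set ℓ
  q ∈ fail  = ⊥
  q ∈ ⌜ P ⌝ = P q

  _⊆_ : Predicate States → Predicate States → Set ℓ
  r ⊆ s = ∀ q → q ∈ r → q ∈ s

  _⪯d_ : Predicate States → Predicate States → Set (suc ℓ)
  r ⪯d s = s ≡ fail ⊎ (r ≢ fail × r ⊆ s)

  -- The join of the set { f i | i ∈ I }.  Excluded middle decides whether
  -- fail is a member of it.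
  ⨆d : ExcludedMiddle (suc ℓ) → {I : Set ℓ} → (I → Predicate States) → Predicate States
  ⨆d em f with em {∃[ i ] f i ≡ fail}
  ... | yes _ = fail
  ... | no  _ = ⌜ (λ q → ∃[ i ] q ∈ f i) ⌝

-- Finite sets are represented by lists, with [_] for singletons and _++_ for
-- unions.  Order and multiplicity of members are immaterial: validity only
-- quantifies over members, and CSQ makes derivability invariant as well.
Selection : Set ℓ → Set (suc ℓ)
Selection States = List (Predicate States)

infix 4 _⪯a_

_⪯a_ : {States : Set ℓ} → Selection States → Selection States → Set (suc ℓ)
R ⪯a S = ∀ s → s ∈ˡ S → ∃[ r ] r ∈ˡ R × r ⪯d s

module Logic
  (em : ExcludedMiddle (suc ℓ))
  {States Command : Set ℓ} (sem : Command → States → Predicate States)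
  {n : ℕ} (prod : Fin n → Pred (Sketch Command n) ℓ)
  where

  open Grammar prod public

  ⟦_⟧ : Command → Predicate States → Predicate States
  ⟦ c ⟧ fail  = fail
  ⟦ c ⟧ ⌜ P ⌝ = ⨆d em {I = Σ States P} λ i → sem c (proj₁ i)

  ⟦_⟧ₑ : List Command → Predicate States → Predicate States
  ⟦ e ⟧ₑ r = foldl (λ t c → ⟦ c ⟧ t) r e

  ⊨d⟨_⟩_⟨_⟩ : Predicate States → Program Command → Predicate States → Set (suc ℓ)
  ⊨d⟨ r ⟩ p ⟨ s ⟩ = ∀ e → exec p e → ⟦ e ⟧ₑ r ⪯d s

  ⊨a⟨_⟩_⟨_⟩ : Selection States → Sketch Command n → Selection States → Set (suc ℓ)
  ⊨a⟨ R ⟩ sk ⟨ S ⟩ =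
    ∀ s → s ∈ˡ S → ∃[ r ] r ∈ˡ R × (∃[ p ] drv sk p × ⊨d⟨ r ⟩ p ⟨ s ⟩)

  data ⊢a⟨_⟩_⟨_⟩ : Selection States → Sketch Command n → Selection States → Set (suc ℓ) where
    COM    : ∀ {c r s} → ⟦ c ⟧ r ⪯d s →
             ⊢a⟨ [ r ] ⟩ com c ⟨ [ s ] ⟩
    SEQ    : ∀ {R S T sk₁ sk₂} →
             ⊢a⟨ R ⟩ sk₁ ⟨ S ⟩ → ⊢a⟨ S ⟩ sk₂ ⟨ T ⟩ →
             ⊢a⟨ R ⟩ sk₁ ⨾ sk₂ ⟨ T ⟩
    LOOP   : ∀ {r sk} →
             ⊢a⟨ [ r ] ⟩ sk ⟨ [ r ] ⟩ →
             ⊢a⟨ [ r ] ⟩ sk ⋆ ⟨ [ r ] ⟩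
    CSQ    : ∀ {R R′ S S′ sk} →
             R ⪯a R′ → S′ ⪯a S → ⊢a⟨ R′ ⟩ sk ⟨ S′ ⟩ →
             ⊢a⟨ R ⟩ sk ⟨ S ⟩
    DEM    : ∀ {r S sk₁ sk₂} →
             ⊢a⟨ [ r ] ⟩ sk₁ ⟨ S ⟩ → ⊢a⟨ [ r ] ⟩ sk₂ ⟨ S ⟩ →
             ⊢a⟨ [ r ] ⟩ sk₁ ⊕ sk₂ ⟨ S ⟩
    ANG    : ∀ {R S N sk} → prod N sk →
             ⊢a⟨ R ⟩ sk ⟨ S ⟩ →
             ⊢a⟨ R ⟩ nt N ⟨ S ⟩
    GATHER : ∀ {R₁ R₂ S₁ S₂ sk} →
             ⊢a⟨ R₁ ⟩ sk ⟨ S₁ ⟩ → ⊢a⟨ R₂ ⟩ sk ⟨ S₂ ⟩ →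
             ⊢a⟨ R₁ ++ R₂ ⟩ sk ⟨ S₁ ++ S₂ ⟩
    EMPTY  : ∀ {R sk} → ⊢a⟨ R ⟩ sk ⟨ [] ⟩

{-# OPTIONS --safe #-}

-- Soundness is an induction on derivations.  For completeness it suffices to
-- derive ⟨ r ⟩ sk ⟨ s ⟩ for one program p of sk with ⊨d⟨ r ⟩ p ⟨ s ⟩, since
-- GATHER collects the members of S.  This goes by induction on a big-step
-- derivation of p from sk: the intermediate assertion of a sequence and the
-- invariant of a loop are the joins of ⟦ e ⟧ₑ r over all executions e of the
-- first program and of the loop respectively; they are adequate because
-- executions distribute over joins.

module Submission where

open import Axiom.ExcludedMiddle using (ExcludedMiddle)
open import Data.Empty using (⊥-elim)
open import Data.Fin.Base using (Fin)
open import Data.List.Base using (List; []; _∷_; [_]; _++_)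
open import Data.List.Membership.Propositional using () renaming (_∈_ to _∈ˡ_)
open import Data.List.Membership.Propositional.Properties using (∈-++⁺ˡ; ∈-++⁺ʳ; ∈-++⁻)
open import Data.List.Properties using (++-assoc; ++-identityʳ; foldl-++)
open import Data.List.Relation.Binary.Subset.Propositional using () renaming (_⊆_ to _⊆ˡ_)
open import Data.List.Relation.Unary.Any using (here; there)
open import Data.Nat.Base using (ℕ)
open import Data.Product.Base using (Σ; _,_; proj₁; ∃-syntax)
open import Data.Sum.Base using (inj₁; inj₂; [_,_]′)
open import Function.Base using (id; _∘_)
open import Function.Bundles using (_⇔_; mk⇔)
open import Level using (Level; suc)
open import Relation.Binary.Construct.Closure.ReflexiveTransitive using (Star; ε; _◅_; _◅◅_; gmap)
open import Relation.Binary.PropositionalEquality using (_≡_; refl; sym; subst)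
open import Relation.Nullary using (yes; no)
open import Relation.Unary using (Pred; Satisfiable)
open import Defs

private
  variable
    ℓ : Level

module _ {States : Set ℓ} where

  ⪯d-refl : {r : Predicate States} → r ⪯d r
  ⪯d-refl {fail}  = inj₁ refl
  ⪯d-refl {⌜ _ ⌝} = inj₂ ((λ ()) , λ _ → id)

  ⪯d-trans : {r s t : Predicate States} → r ⪯d s → s ⪯d t → r ⪯d t
  ⪯d-trans _                     (inj₁ t≡fail)       = inj₁ t≡fail
  ⪯d-trans (inj₁ s≡fail)         (inj₂ (s≢fail , _)) = ⊥-elim (s≢fail s≡fail)
  ⪯d-trans (inj₂ (r≢fail , r⊆s)) (inj₂ (_ , s⊆t))    = inj₂ (r≢fail , λ q → s⊆t q ∘ r⊆s q)

  fail-⪯d⁻ : {s : Predicate States} → fail ⪯d s → s ≡ fail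
  fail-⪯d⁻ (inj₁ s≡fail)       = s≡fail
  fail-⪯d⁻ (inj₂ (f≢fail , _)) = ⊥-elim (f≢fail refl)

  ⪯d-⌜⌝⁻ : {r : Predicate States} {P : Pred States ℓ} → r ⪯d ⌜ P ⌝ → r ⊆ ⌜ P ⌝
  ⪯d-⌜⌝⁻ (inj₂ (_ , r⊆P)) = r⊆P

  ⪯a-⊇ : {R S : Selection States} → S ⊆ˡ R → R ⪯a S
  ⪯a-⊇ S⊆R s s∈S = s , S⊆R s∈S , ⪯d-refl

  ⪯a-refl : {R : Selection States} → R ⪯a R
  ⪯a-refl = ⪯a-⊇ id

  ⪯a-[_] : {r s : Predicate States} → r ⪯d s → [ r ] ⪯a [ s ]
  ⪯a-[ r⪯s ] s (here refl) = _ , here refl , r⪯s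

  module _ (em : ExcludedMiddle (suc ℓ)) {I : Set ℓ} (f : I → Predicate States) where

    ⨆d-upper : ∀ i → f i ⪯d ⨆d em f
    ⨆d-upper i with em {∃[ i ] f i ≡ fail}
    ... | yes _      = inj₁ refl
    ... | no no-fail = inj₂ ((λ eq → no-fail (i , eq)) , λ _ q∈fi → i , q∈fi)

    -- If some member is `fail`, then so is every upper bound, as only `fail` lies above `fail`.
    -- Otherwise the join is a plain union.
    ⨆d-least : ∀ {s} → (∀ i → f i ⪯d s) → ⨆d em f ⪯d s
    ⨆d-least {s} f⪯s with em {∃[ i ] f i ≡ fail}
    ... | yes (i , eq) = inj₁ (fail-⪯d⁻ (subst (_⪯d s) eq (f⪯s i)))
    ⨆d-least {fail}  f⪯s | no _ = inj₁ refl
    ⨆d-least {⌜ _ ⌝} f⪯s | no _ = inj₂ ((λ ()) , λ q (i , q∈fi) → ⪯d-⌜⌝⁻ (f⪯s i) q q∈fi)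

-- `iter` adds an iteration in front, whereas invariance of the join over all executions of a loop
-- calls for one at the end.
exec-⋆-snoc : {Command : Set ℓ} {p : Program Command} {e₁ e₂ : List Command} →
              exec (p ⋆) e₁ → exec p e₂ → exec (p ⋆) (e₁ ++ e₂)
exec-⋆-snoc {e₂ = e₂} stop x₂ = subst (exec _) (++-identityʳ e₂) (iter x₂ stop)
exec-⋆-snoc (iter {e₁ = e} {e₂ = e′} x x′) x₂ =
  subst (exec _) (sym (++-assoc e e′ _)) (iter x (exec-⋆-snoc x′ x₂))

module BigStep {Command : Set ℓ} {n : ℕ} (prod : Fin n → Pred (Sketch Command n) ℓ) where

  open Grammar prod

  infix 4 _⇓_

  -- A derivation here follows the shape of the sketch and continues below each chosen production.
  -- Induction on it therefore works for recursive grammars, where induction on the sketch would get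
  -- stuck at `nt`.
  data _⇓_ : Sketch Command n → Program Command → Set ℓ where
    com : ∀ {c} → com c ⇓ com c
    _⨾_ : ∀ {sk₁ sk₂ p₁ p₂} → sk₁ ⇓ p₁ → sk₂ ⇓ p₂ → sk₁ ⨾ sk₂ ⇓ p₁ ⨾ p₂
    _⊕_ : ∀ {sk₁ sk₂ p₁ p₂} → sk₁ ⇓ p₁ → sk₂ ⇓ p₂ → sk₁ ⊕ sk₂ ⇓ p₁ ⊕ p₂
    _⋆  : ∀ {sk p} → sk ⇓ p → sk ⋆ ⇓ p ⋆
    nt  : ∀ {N sk p} → prod N sk → sk ⇓ p → nt N ⇓ p

  ⌊⌋-⇓ : ∀ p → ⌊ p ⌋ ⇓ p
  ⌊⌋-⇓ (com c)   = com
  ⌊⌋-⇓ (p₁ ⨾ p₂) = ⌊⌋-⇓ p₁ ⨾ ⌊⌋-⇓ p₂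
  ⌊⌋-⇓ (p₁ ⊕ p₂) = ⌊⌋-⇓ p₁ ⊕ ⌊⌋-⇓ p₂
  ⌊⌋-⇓ (p ⋆)     = ⌊⌋-⇓ p ⋆

  -- Where the occurrence was replaced, `d` contains a derivation from the production; `nt` puts the
  -- non-terminal back on top of it.
  ⇒-⇓ : ∀ {sk sk′ p} → sk ⇒ sk′ → sk′ ⇓ p → sk ⇓ p
  ⇒-⇓ (expand N∋sk) d         = nt N∋sk d
  ⇒-⇓ (seqˡ x)      (d₁ ⨾ d₂) = ⇒-⇓ x d₁ ⨾ d₂
  ⇒-⇓ (seqʳ x)      (d₁ ⨾ d₂) = d₁ ⨾ ⇒-⇓ x d₂
  ⇒-⇓ (altˡ x)      (d₁ ⊕ d₂) = ⇒-⇓ x d₁ ⊕ d₂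
  ⇒-⇓ (altʳ x)      (d₁ ⊕ d₂) = d₁ ⊕ ⇒-⇓ x d₂
  ⇒-⇓ (loop x)      (d ⋆)     = ⇒-⇓ x d ⋆

  ⇒*-⇓ : ∀ {sk sk′ p} → Star _⇒_ sk sk′ → sk′ ⇓ p → sk ⇓ p
  ⇒*-⇓ ε        d = d
  ⇒*-⇓ (x ◅ xs) d = ⇒-⇓ x (⇒*-⇓ xs d)

  drv⇒⇓ : ∀ {sk p} → drv sk p → sk ⇓ p
  drv⇒⇓ {p = p} xs = ⇒*-⇓ xs (⌊⌋-⇓ p)

module Metatheory
  (em : ExcludedMiddle (suc ℓ))
  {States Command : Set ℓ} (sem : Command → States → Predicate States)
  {n : ℕ} (prod : Fin n → Pred (Sketch Command n) ℓ)
  where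

  open Logic em sem prod
  open BigStep prod

  sem-⪯d-⟦⟧ : ∀ c r {q} → q ∈ r → sem c q ⪯d ⟦ c ⟧ r
  sem-⪯d-⟦⟧ c ⌜ _ ⌝ q∈r = ⨆d-upper em (sem c ∘ proj₁) (_ , q∈r)

  ⟦⟧-mono : ∀ c {r s} → r ⪯d s → ⟦ c ⟧ r ⪯d ⟦ c ⟧ s
  ⟦⟧-mono c             (inj₁ refl)         = inj₁ refl
  ⟦⟧-mono c {fail}      (inj₂ (r≢fail , _)) = ⊥-elim (r≢fail refl)
  ⟦⟧-mono c {⌜ _ ⌝} {s} (inj₂ (_ , r⊆s))    =
    ⨆d-least em _ λ (q , q∈r) → sem-⪯d-⟦⟧ c s (r⊆s q q∈r)

  ⟦⟧ₑ-mono : ∀ e {r s} → r ⪯d s → ⟦ e ⟧ₑ r ⪯d ⟦ e ⟧ₑ s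
  ⟦⟧ₑ-mono []      r⪯s = r⪯s
  ⟦⟧ₑ-mono (c ∷ e) r⪯s = ⟦⟧ₑ-mono e (⟦⟧-mono c r⪯s)

  module _ {I : Set ℓ} where

    ⟦⟧-⨆d : ∀ c (f : I → Predicate States) → ⟦ c ⟧ (⨆d em f) ⪯d ⨆d em (⟦ c ⟧ ∘ f)
    ⟦⟧-⨆d c f with em {∃[ i ] f i ≡ fail}
    -- The left side has become `⟦ c ⟧ fail`, which is `⟦ c ⟧ (f i)` up to `eq`.
    ... | yes (i , eq) =
      subst (λ r → ⟦ c ⟧ r ⪯d ⨆d em (⟦ c ⟧ ∘ f)) eq (⨆d-upper em (⟦ c ⟧ ∘ f) i)
    ... | no _ = ⨆d-least em _ λ (q , i , q∈fi) →
      ⪯d-trans (sem-⪯d-⟦⟧ c (f i) q∈fi) (⨆d-upper em (⟦ c ⟧ ∘ f) i)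

    ⟦⟧ₑ-⨆d : ∀ e (f : I → Predicate States) → ⟦ e ⟧ₑ (⨆d em f) ⪯d ⨆d em (⟦ e ⟧ₑ ∘ f)
    ⟦⟧ₑ-⨆d []      f = ⪯d-refl
    ⟦⟧ₑ-⨆d (c ∷ e) f = ⪯d-trans (⟦⟧ₑ-mono e (⟦⟧-⨆d c f)) (⟦⟧ₑ-⨆d e (⟦ c ⟧ ∘ f))

  ⟦++⟧ₑ : ∀ e₁ e₂ r → ⟦ e₁ ++ e₂ ⟧ₑ r ≡ ⟦ e₂ ⟧ₑ (⟦ e₁ ⟧ₑ r)
  ⟦++⟧ₑ e₁ e₂ r = foldl-++ _ r e₁ e₂

  ⟦++⟧ₑ-⪯d : ∀ e₁ e₂ {r s t} → ⟦ e₁ ⟧ₑ r ⪯d s → ⟦ e₂ ⟧ₑ s ⪯d t → ⟦ e₁ ++ e₂ ⟧ₑ r ⪯d t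
  ⟦++⟧ₑ-⪯d e₁ e₂ {r} h₁ h₂ =
    subst (_⪯d _) (sym (⟦++⟧ₑ e₁ e₂ r)) (⪯d-trans (⟦⟧ₑ-mono e₂ h₁) h₂)

  ⊨d-⨾ : ∀ {r s t p₁ p₂} → ⊨d⟨ r ⟩ p₁ ⟨ s ⟩ → ⊨d⟨ s ⟩ p₂ ⟨ t ⟩ → ⊨d⟨ r ⟩ p₁ ⨾ p₂ ⟨ t ⟩
  ⊨d-⨾ v₁ v₂ _ (seq {e₁ = e₁} {e₂ = e₂} x₁ x₂) = ⟦++⟧ₑ-⪯d e₁ e₂ (v₁ e₁ x₁) (v₂ e₂ x₂)

  ⊨d-⊕ : ∀ {r s p₁ p₂} → ⊨d⟨ r ⟩ p₁ ⟨ s ⟩ → ⊨d⟨ r ⟩ p₂ ⟨ s ⟩ → ⊨d⟨ r ⟩ p₁ ⊕ p₂ ⟨ s ⟩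
  ⊨d-⊕ v₁ v₂ e (left x)  = v₁ e x
  ⊨d-⊕ v₁ v₂ e (right x) = v₂ e x

  ⊨d-⋆ : ∀ {r p} → ⊨d⟨ r ⟩ p ⟨ r ⟩ → ⊨d⟨ r ⟩ p ⋆ ⟨ r ⟩
  ⊨d-⋆ v _ stop = ⪯d-refl
  ⊨d-⋆ v _ (iter {e₁ = e₁} {e₂ = e₂} x₁ x₂) = ⟦++⟧ₑ-⪯d e₁ e₂ (v e₁ x₁) (⊨d-⋆ v e₂ x₂)

  ⊨d-csq : ∀ {r r′ s s′ p} → r ⪯d r′ → s′ ⪯d s → ⊨d⟨ r′ ⟩ p ⟨ s′ ⟩ → ⊨d⟨ r ⟩ p ⟨ s ⟩
  ⊨d-csq r⪯r′ s′⪯s v e x = ⪯d-trans (⟦⟧ₑ-mono e r⪯r′) (⪯d-trans (v e x) s′⪯s)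

  drv-⨾ : ∀ {sk₁ sk₂ p₁ p₂} → drv sk₁ p₁ → drv sk₂ p₂ → drv (sk₁ ⨾ sk₂) (p₁ ⨾ p₂)
  drv-⨾ d₁ d₂ = gmap (_⨾ _) seqˡ d₁ ◅◅ gmap (_ ⨾_) seqʳ d₂

  drv-⊕ : ∀ {sk₁ sk₂ p₁ p₂} → drv sk₁ p₁ → drv sk₂ p₂ → drv (sk₁ ⊕ sk₂) (p₁ ⊕ p₂)
  drv-⊕ d₁ d₂ = gmap (_⊕ _) altˡ d₁ ◅◅ gmap (_ ⊕_) altʳ d₂

  sound : ∀ {R sk S} → ⊢a⟨ R ⟩ sk ⟨ S ⟩ → ⊨a⟨ R ⟩ sk ⟨ S ⟩
  sound (COM {c} h) s (here refl) = _ , here refl , com c , ε , λ { _ com → h }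
  sound (SEQ D₁ D₂) t t∈T =
    -- The search runs backwards: `t` determines `s` through the second premise, and `s` determines
    -- `r` through the first.
    let s , s∈S , p₂ , d₂ , v₂ = sound D₂ t t∈T
        r , r∈R , p₁ , d₁ , v₁ = sound D₁ s s∈S
    in r , r∈R , p₁ ⨾ p₂ , drv-⨾ d₁ d₂ , ⊨d-⨾ v₁ v₂
  sound (LOOP D) r (here refl) with sound D r (here refl)
  -- As the selection is a singleton, the precondition found is `r` itself, so `r` is an invariant
  -- of `p`.
  ... | _ , here refl , p , d , v = r , here refl , p ⋆ , gmap _⋆ loop d , ⊨d-⋆ v
  sound (CSQ R⪯R′ S′⪯S D) s s∈S =
    let s′ , s′∈S′ , s′⪯s      = S′⪯S s s∈S
        r′ , r′∈R′ , p , d , v = sound D s′ s′∈S′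
        r , r∈R , r⪯r′         = R⪯R′ r′ r′∈R′
    in r , r∈R , p , d , ⊨d-csq r⪯r′ s′⪯s v
  sound (DEM D₁ D₂) s s∈S with sound D₁ s s∈S | sound D₂ s s∈S
  -- The singleton forces both branches to start from the same `r`; members of a larger selection
  -- could differ between `p₁` and `p₂`.
  ... | r , here refl , p₁ , d₁ , v₁ | _ , here refl , p₂ , d₂ , v₂ =
    r , here refl , p₁ ⊕ p₂ , drv-⊕ d₁ d₂ , ⊨d-⊕ v₁ v₂
  sound (ANG N∋sk D) s s∈S =
    let r , r∈R , p , d , v = sound D s s∈S
    in r , r∈R , p , expand N∋sk ◅ d , v
  sound (GATHER {R₁ = R₁} {S₁ = S₁} D₁ D₂) s s∈S with ∈-++⁻ S₁ s∈S
  ... | inj₁ s∈S₁ = let r , r∈R₁ , v = sound D₁ s s∈S₁ in r , ∈-++⁺ˡ r∈R₁ , v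
  ... | inj₂ s∈S₂ = let r , r∈R₂ , v = sound D₂ s s∈S₂ in r , ∈-++⁺ʳ R₁ r∈R₂ , v

  strongest-post : Predicate States → Program Command → Predicate States
  strongest-post r p = ⨆d em {I = Σ (List Command) (exec p)} λ (e , _) → ⟦ e ⟧ₑ r

  ⊨d-strongest-post : ∀ r p → ⊨d⟨ r ⟩ p ⟨ strongest-post r p ⟩
  ⊨d-strongest-post r p e x = ⨆d-upper em _ (e , x)

  strongest-post-least : ∀ {r p s} → ⊨d⟨ r ⟩ p ⟨ s ⟩ → strongest-post r p ⪯d s
  strongest-post-least v = ⨆d-least em _ λ (e , x) → v e x

  -- Running `e₂` from the join is bounded by the join of the runs of `e₂` from each `⟦ e₁ ⟧ₑ r`,
  -- and these are runs of `e₁ ++ e₂` from `r`.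
  ⟦⟧ₑ-strongest-post : ∀ {r p s} e₂ → (∀ e₁ → exec p e₁ → ⟦ e₁ ++ e₂ ⟧ₑ r ⪯d s) →
                       ⟦ e₂ ⟧ₑ (strongest-post r p) ⪯d s
  ⟦⟧ₑ-strongest-post {r} e₂ h = ⪯d-trans (⟦⟧ₑ-⨆d e₂ _)
    (⨆d-least em _ λ (e₁ , x₁) → subst (_⪯d _) (⟦++⟧ₑ e₁ e₂ r) (h e₁ x₁))

  ⇓-complete : ∀ {sk p r s} → sk ⇓ p → ⊨d⟨ r ⟩ p ⟨ s ⟩ → ⊢a⟨ [ r ] ⟩ sk ⟨ [ s ] ⟩
  ⇓-complete com v = COM (v _ com)
  ⇓-complete {r = r} (_⨾_ {p₁ = p₁} d₁ d₂) v =
    SEQ (⇓-complete d₁ (⊨d-strongest-post r p₁))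
        (⇓-complete d₂ λ e₂ x₂ → ⟦⟧ₑ-strongest-post e₂ λ e₁ x₁ → v _ (seq x₁ x₂))
  ⇓-complete (d₁ ⊕ d₂) v =
    DEM (⇓-complete d₁ λ e x → v e (left x)) (⇓-complete d₂ λ e x → v e (right x))
  ⇓-complete {r = r} (_⋆ {p = p} d) v =
    -- The empty execution places `r` below the invariant, and validity places the invariant below
    -- `s`.
    CSQ ⪯a-[ ⊨d-strongest-post r (p ⋆) [] stop ] ⪯a-[ strongest-post-least v ]
      (LOOP (⇓-complete d λ e₂ x₂ → ⟦⟧ₑ-strongest-post e₂ λ e₁ x₁ →
        ⊨d-strongest-post r (p ⋆) _ (exec-⋆-snoc x₁ x₂)))
  ⇓-complete (nt N∋sk d) v = ANG N∋sk (⇓-complete d v)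

  complete : ∀ {R sk} S → ⊨a⟨ R ⟩ sk ⟨ S ⟩ → ⊢a⟨ R ⟩ sk ⟨ S ⟩
  complete [] v = EMPTY
  complete {R} (s ∷ S) v =
    let r , r∈R , p , d , v₁ = v s (here refl)
    -- `GATHER` yields the precondition `[ r ] ++ R`; since `r` is already in `R`, `CSQ` reduces it
    -- to `R`.
    in CSQ (⪯a-⊇ (λ x∈ → [ (λ { (here refl) → r∈R }) , id ]′ (∈-++⁻ [ r ] x∈))) ⪯a-refl
         (GATHER (⇓-complete (drv⇒⇓ d) v₁) (complete S λ s′ s′∈S → v s′ (there s′∈S)))

theorem3p1 : {ℓ : Level} (em : ExcludedMiddle (suc ℓ))
    (States Command : Set ℓ) (sem : Command → States → Predicate States)
    (n : ℕ) (prod : Fin n → Pred (Sketch Command n) ℓ) (prod-nonempty : ∀ N → Satisfiable (prod N)) →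
    let open Logic em sem prod in
    (R S : Selection States) (sk : Sketch Command n) →
    ⊢a⟨ R ⟩ sk ⟨ S ⟩ ⇔ ⊨a⟨ R ⟩ sk ⟨ S ⟩
theorem3p1 em States Command sem n prod prod-nonempty R S sk = mk⇔ sound (complete S)
  where open Metatheory em sem prod
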